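{- Let $\mathcal{C}$ be a hereditary graph class such that for every graph $G$ and vertex $v\in V(G)$ with $G-v\in\mathcal{C}$, the minimum size of a $\mathcal{C}$-modulator of $G$ not containing $v$ equals the $\mathsf{forb}(\mathcal{C})$-flower number of $v$ in $G$. Suppose there is a polynomial-time algorithm that, given a graph $G$ and $v\in V(G)$, computes the $\mathsf{forb}(\mathcal{C})$-flower number of $v$ in $G$. Then there is a polynomial-time algorithm for 2-Essential Detection for $\mathcal{C}$-Deletion.
   Context: For a hereditary graph class $\mathcal{C}$, $\mathsf{forb}(\mathcal{C})$ is a set of forbidden induced subgraphs characterizing $\mathcal{C}$ (a graph is in $\mathcal{C}$ iff no induced subgraph is isomorphic to a member of $\mathsf{forb}(\mathcal{C})$). A $\mathcal{C}$-modulator of $G$ is a set $S\subseteq V(G)$ with $G-S\in\mathcal{C}$; $\mathrm{opt}_\mathcal{C}(G)$ is the minimum size of one. $\mathcal{C}$-Deletion: given $G$, find a minimum $\mathcal{C}$-modulator. For a set of graphs $\mathcal{F}$, a graph $G$ and $v\in V(G)$, a $(v,\mathcal{F})$-flower with $p$ petals is a set $\{C_1,\dots,C_p\}$ of induced subgraphs of $G$, each isomorphic to a member of $\mathcal{F}$, with $V(C_i)\cap V(C_j)=\{v\}$ for all distinct $i,j$; the $\mathcal{F}$-flower number of $v$ is the maximum $p$ for which such a flower exists. For a vertex-subset minimization problem $\Pi$ with optimum $\mathrm{opt}_\Pi(G)$, a vertex $v$ is $c$-essential if every feasible solution of size at most $c\cdot\mathrm{opt}_\Pi(G)$ contains $v$.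 The problem $c$-Essential Detection for $\Pi$ is: given a graph $G$ and integer $k$, output $S\subseteq V(G)$ such that (G1) if $\mathrm{opt}_\Pi(G)\le k$ then some optimal solution contains $S$, and (G2) if $\mathrm{opt}_\Pi(G)=k$ then $S$ contains all $c$-essential vertices. -}

module Defs where

open import Data.Bool.Base using (Bool; true; false)
open import Data.Fin.Base using (Fin; zero; suc; toℕ)
open import Data.Fin.Subset
  using (Subset; inside; outside; ∣_∣; ∁; ⁅_⁆; _∈_; _⊆_; _∩_)
open import Data.Integer.Base as ℤ using (ℤ; +_; -[1+_])
open import Data.Nat.Base using (ℕ; zero; suc; _+_; _*_; _^_; _≤_)
import Data.Nat.Binary.Base as Bin
open import Data.Product.Base using (Σ; ∃; _×_; _,_)
open import Data.Vec.Base as Vec using (Vec; []; _∷_)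
open import Function.Base using (_∘_)
open import Function.Bundles using (_↔_; _⇔_; module Inverse)
open import Function.Definitions using (Injective)
open import Level using (Level; _⊔_) renaming (suc to lsuc)
open import Relation.Binary.PropositionalEquality
  using (_≡_; _≢_; refl)
open import Relation.Nullary.Negation.Core using (¬_)

private
  variable
    a b c f ℓ : Level

record Graph : Set where
  field
    order  : ℕ
    adj    : Fin order → Fin order → Bool
    sym    : ∀ u v → adj u v ≡ adj v u
    irrefl : ∀ v → adj v v ≡ false

  Vertex : Set
  Vertex = Fin order

  VertexSet : Set
  VertexSet = Subset order

open Graph public using (order; adj; Vertex; VertexSet)

infix 4 _≅_

_≅_ : Graph → Graph → Set
G ≅ H = Σ (Vertex G ↔ Vertex H) λ φ →
  ∀ u v → adj G u v ≡ adj H (Inverse.to φ u) (Inverse.to φ v)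

enumerate : ∀ {n} (S : Subset n) → Fin ∣ S ∣ → Fin n
enumerate (inside  ∷ S) zero    = zero
enumerate (inside  ∷ S) (suc i) = suc (enumerate S i)
enumerate (outside ∷ S) i       = suc (enumerate S i)

infixl 8 _[_] _∖_

_[_] : (G : Graph) → VertexSet G → Graph
G [ S ] = record
  { order  = ∣ S ∣
  ; adj    = λ i j → adj G (enumerate S i) (enumerate S j)
  ; sym    = λ i j → Graph.sym G (enumerate S i) (enumerate S j)
  ; irrefl = λ i → Graph.irrefl G (enumerate S i)
  }

_∖_ : (G : Graph) → VertexSet G → Graph
G ∖ S = G [ ∁ S ]

GraphClass : (ℓ : Level) → Set (lsuc ℓ)
GraphClass ℓ = Graph → Set ℓ

record Hereditary (C : GraphClass ℓ) : Set ℓ where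
  field
    resp-≅  : ∀ {G H} → G ≅ H → C G → C H
    induced : ∀ {G} (S : VertexSet G) → C G → C (G [ S ])

IsoToMember : GraphClass f → Graph → Set f
IsoToMember F G = ∃ λ H → F H × G ≅ H

IsForb : GraphClass c → GraphClass f → Set (c ⊔ f)
IsForb C F = ∀ G → C G ⇔ (¬ ∃ λ S → IsoToMember F (G [ S ]))

-- An induced subgraph of G is given by its vertex set; injectivity of
-- `petal` says that the p petals form a set of p elements.

record Flower (F : GraphClass f) (G : Graph) (v : Vertex G) (p : ℕ)
              : Set f where
  field
    petal     : Fin p → VertexSet G
    injective : Injective _≡_ _≡_ petal
    forbidden : ∀ i → IsoToMember F (G [ petal i ])
    meet      : ∀ i j → i ≢ j → petal i ∩ petal j ≡ ⁅ v ⁆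

IsFlowerNumber : GraphClass f → (G : Graph) → Vertex G → ℕ → Set f
IsFlowerNumber F G v p = Flower F G v p × (∀ q → Flower F G v q → q ≤ p)

IsMinSize : ∀ {n} → (Subset n → Set ℓ) → ℕ → Set ℓ
IsMinSize P m =
  (∃ λ S → P S × ∣ S ∣ ≡ m) × (∀ S → P S → m ≤ ∣ S ∣)

-- A minimization problem is given by its feasible solutions.

Problem : (ℓ : Level) → Set (lsuc ℓ)
Problem ℓ = (G : Graph) → VertexSet G → Set ℓ

IsOpt : Problem ℓ → Graph → ℕ → Set ℓ
IsOpt Π G = IsMinSize (Π G)

OptimalSolution : (Π : Problem ℓ) (G : Graph) → VertexSet G → Set ℓ
OptimalSolution Π G S = Π G S × IsOpt Π G ∣ S ∣

Essential : ℕ → Problem ℓ → (G : Graph) → Vertex G → Set ℓ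
Essential α Π G v =
  ∀ m → IsOpt Π G m → ∀ S → Π G S → ∣ S ∣ ≤ α * m → v ∈ S

record EssentialDetection (α : ℕ) (Π : Problem ℓ)
                          (G : Graph) (k : ℤ) (S : VertexSet G)
                          : Set ℓ where
  field
    G1 : ∀ m → IsOpt Π G m → + m ℤ.≤ k →
         ∃ λ X → OptimalSolution Π G X × S ⊆ X
    G2 : ∀ m → IsOpt Π G m → + m ≡ k →
         ∀ v → Essential α Π G v → v ∈ S

Modulator : GraphClass c → (G : Graph) → VertexSet G → Set c
Modulator C G S = C (G ∖ S)

Deletion : GraphClass c → Problem c
Deletion C = Modulator C

data Tree : Set where
  nil  : Tree
  cons : Tree → Tree → Tree

size : Tree → ℕ
size nil        = 1
size (cons x y) = suc (size x + size y)

infixr 5 _⨾_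

-- This is Jones's WHILE language with the store kept in a single tree.
-- `nil` stands for false and every other tree for true.

data Program : Set where
  skip  : Program
  const : Tree → Program
  hd tl : Program
  pair  : Program → Program → Program
  _⨾_   : Program → Program → Program
  if    : Program → Program → Program → Program
  while : Program → Program → Program

head tail : Tree → Tree
head nil        = nil
head (cons x _) = x
tail nil        = nil
tail (cons _ y) = y

infix 4 _⊢_⇓_⟨_⟩

-- p ⊢ x ⇓ y ⟨ t ⟩ : on input x, p halts with output y after t steps.
-- Steps have unit cost, as subtrees are shared rather than copied; on a
-- pointer machine each of them takes constant time.  Polynomial time in
-- this sense is therefore the usual one for functions whose outputs have
-- polynomial size, which is the case for the encodings below.

data _⊢_⇓_⟨_⟩ : Program → Tree → Tree → ℕ → Set where
  skip  : ∀ {x} → skip ⊢ x ⇓ x ⟨ 1 ⟩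
  const : ∀ {x y} → const y ⊢ x ⇓ y ⟨ 1 ⟩
  hd    : ∀ {x} → hd ⊢ x ⇓ head x ⟨ 1 ⟩
  tl    : ∀ {x} → tl ⊢ x ⇓ tail x ⟨ 1 ⟩
  pair  : ∀ {p q x y z s t} →
          p ⊢ x ⇓ y ⟨ s ⟩ → q ⊢ x ⇓ z ⟨ t ⟩ →
          pair p q ⊢ x ⇓ cons y z ⟨ suc (s + t) ⟩
  seq   : ∀ {p q x y z s t} →
          p ⊢ x ⇓ y ⟨ s ⟩ → q ⊢ y ⇓ z ⟨ t ⟩ →
          p ⨾ q ⊢ x ⇓ z ⟨ suc (s + t) ⟩
  if-true  : ∀ {r p q x y u v s t} →
             r ⊢ x ⇓ cons u v ⟨ s ⟩ → p ⊢ x ⇓ y ⟨ t ⟩ →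
             if r p q ⊢ x ⇓ y ⟨ suc (s + t) ⟩
  if-false : ∀ {r p q x y s t} →
             r ⊢ x ⇓ nil ⟨ s ⟩ → q ⊢ x ⇓ y ⟨ t ⟩ →
             if r p q ⊢ x ⇓ y ⟨ suc (s + t) ⟩
  while-stop : ∀ {r p x s} →
               r ⊢ x ⇓ nil ⟨ s ⟩ →
               while r p ⊢ x ⇓ x ⟨ suc s ⟩
  while-step : ∀ {r p x y z u v s t w} →
               r ⊢ x ⇓ cons u v ⟨ s ⟩ → p ⊢ x ⇓ y ⟨ t ⟩ →
               while r p ⊢ y ⇓ z ⟨ w ⟩ →
               while r p ⊢ x ⇓ z ⟨ suc (s + t + w) ⟩

deterministic : ∀ {p x y z s t} →
                p ⊢ x ⇓ y ⟨ s ⟩ → p ⊢ x ⇓ z ⟨ t ⟩ → y ≡ z × s ≡ t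
deterministic skip  skip  = refl , refl
deterministic const const = refl , refl
deterministic hd    hd    = refl , refl
deterministic tl    tl    = refl , refl
deterministic (pair d e) (pair d′ e′)
  with refl , refl ← deterministic d d′
  with refl , refl ← deterministic e e′ = refl , refl
deterministic (seq d e) (seq d′ e′)
  with refl , refl ← deterministic d d′
  with refl , refl ← deterministic e e′ = refl , refl
deterministic (if-true d e) (if-true d′ e′)
  with refl , refl ← deterministic d d′
  with refl , refl ← deterministic e e′ = refl , refl
deterministic (if-true d _) (if-false d′ _)
  with () , _ ← deterministic d d′
deterministic (if-false d _) (if-true d′ _)
  with () , _ ← deterministic d d′
deterministic (if-false d e) (if-false d′ e′)
  with refl , refl ← deterministic d d′
  with refl , refl ← deterministic e e′ = refl , refl
deterministic (while-stop d) (while-stop d′)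
  with refl , refl ← deterministic d d′ = refl , refl
deterministic (while-stop d) (while-step d′ _ _)
  with () , _ ← deterministic d d′
deterministic (while-step d _ _) (while-stop d′)
  with () , _ ← deterministic d d′
deterministic (while-step d e g) (while-step d′ e′ g′)
  with refl , refl ← deterministic d d′
  with refl , refl ← deterministic e e′
  with refl , refl ← deterministic g g′ = refl , refl

-- As `size` is positive, every polynomial in it is bounded by one of the
-- form coeff * size ^ degree.

record PolyTimeAlgorithm {I : Set a} {O : I → Set b}
                         (encodeIn : I → Tree)
                         (encodeOut : ∀ {x} → O x → Tree)
                         (Correct : (x : I) → O x → Set ℓ)
                         : Set (a ⊔ b ⊔ ℓ) where
  field
    program      : Program
    coeff degree : ℕ
    solves       : ∀ x → ∃ λ (y : O x) → ∃ λ t →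
                   program ⊢ encodeIn x ⇓ encodeOut y ⟨ t ⟩ ×
                   t ≤ coeff * size (encodeIn x) ^ degree ×
                   Correct x y

encodeBool : Bool → Tree
encodeBool false = nil
encodeBool true  = cons nil nil

encodeVec : ∀ {A : Set a} {n} → (A → Tree) → Vec A n → Tree
encodeVec e []       = nil
encodeVec e (x ∷ xs) = cons (e x) (encodeVec e xs)

-- Numbers are written in binary (bijective base 2, least significant
-- digit first).

encodeℕᵇ : Bin.ℕᵇ → Tree
encodeℕᵇ Bin.zero     = nil
encodeℕᵇ Bin.2[1+ x ] = cons (encodeBool true) (encodeℕᵇ x)
encodeℕᵇ Bin.1+[2 x ] = cons (encodeBool false) (encodeℕᵇ x)

encodeℕ : ℕ → Tree
encodeℕ = encodeℕᵇ ∘ Bin.fromℕ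

encodeℤ : ℤ → Tree
encodeℤ (+ n)    = cons (encodeBool false) (encodeℕ n)
encodeℤ -[1+ n ] = cons (encodeBool true) (encodeℕ n)

encodeGraph : Graph → Tree
encodeGraph G =
  encodeVec (encodeVec encodeBool)
            (Vec.tabulate λ u → Vec.tabulate λ v → adj G u v)

-- A vertex is written in unary.  It always accompanies its graph, whose
-- adjacency matrix is larger.

encodeFin : ∀ {n} → Fin n → Tree
encodeFin zero    = nil
encodeFin (suc i) = cons nil (encodeFin i)

encodeSubset : ∀ {n} → Subset n → Tree
encodeSubset = encodeVec encodeBool

encodeGraphVertex : Σ Graph Vertex → Tree
encodeGraphVertex (G , v) = cons (encodeGraph G) (encodeFin v)

encodeGraphInteger : Graph × ℤ → Tree
encodeGraphInteger (G , k) = cons (encodeGraph G) (encodeℤ k)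

PolyTimeFlowerNumber : GraphClass f → Set f
PolyTimeFlowerNumber F =
  PolyTimeAlgorithm {O = λ _ → ℕ} encodeGraphVertex encodeℕ
    (λ (G , v) → IsFlowerNumber F G v)

PolyTimeEssentialDetection : ℕ → Problem ℓ → Set ℓ
PolyTimeEssentialDetection α Π =
  PolyTimeAlgorithm {O = λ (G , _) → VertexSet G}
    encodeGraphInteger encodeSubset
    (λ (G , k) → EssentialDetection α Π G k)

{-# OPTIONS --safe #-}

-- The algorithm outputs the set S of vertices whose flower number exceeds k.
-- (G1) A modulator avoiding v meets the petals at v in distinct vertices, so a
-- modulator of size at most k contains S.
-- (G2) Let X be an optimal solution, of size k, and let v be 2-essential; then
-- v ∈ X.  In G′ = G − (X − v) the vertex v alone is a modulator, so the minimum
-- size of a modulator Y of G′ avoiding v is the flower number of v in G′, which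
-- is at most that of v in G.  Were the latter at most k, then (X − v) ∪ Y would
-- be a modulator of G of size at most 2k avoiding v.

module Submission where

open import Defs
open import Data.Bool.Base using (Bool; true; false)
open import Data.Fin.Base using (Fin; zero; suc; inject₁; fromℕ)
open import Data.Fin.Properties using (injective⇒≤; suc-injective; _≟_)
open import Data.Fin.Subset
  using (Subset; inside; outside; ∣_∣; ∁; ⁅_⁆; ⊥; _∈_; _∉_; _∩_; _∪_; _─_; _-_; _⊆_)
open import Data.Fin.Subset.Properties
open import Data.Integer.Base as ℤ using (ℤ; +_; -[1+_]; +≤+)
open import Data.Nat.Base
  using (ℕ; zero; suc; _+_; _*_; _^_; _≤_; _<_; z≤n; s≤s; >-nonZero)
open import Data.Nat.Binary.Base as Bin using (ℕᵇ; 2[1+_]; 1+[2_])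
import Data.Nat.Binary.Properties as Bin
open import Data.Nat.Properties hiding (_≟_; suc-injective)
open import Data.Nat.Tactic.RingSolver using (solve-∀)
open import Data.Product.Base using (∃; _×_; _,_; proj₁; proj₂)
open import Data.Sum.Base using (_⊎_; inj₁; inj₂)
open import Data.Vec.Base using (Vec; []; _∷_; here; there; lookup; tabulate)
open import Data.Vec.Properties
  using (∷-injectiveˡ; ∷-injectiveʳ; []=⇒lookup; lookup⇒[]=; lookup∘tabulate)
open import Function.Base using (_∘_)
open import Function.Bundles using (_⇔_; mk⇔; mk↔ₛ′; module Equivalence; module Inverse)
open import Function.Definitions using (Injective)
open import Function.Properties.Inverse using (↔-sym; ↔-trans)
open import Level using (Level)
open import Relation.Binary.PropositionalEquality
  using (_≡_; refl; sym; trans; cong; cong₂; subst)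
open import Relation.Nullary.Decidable.Core using (yes; no)
open import Relation.Nullary.Negation.Core using (¬_; contradiction)

private
  variable
    a c f : Level
    n : ℕ

-- Subsets of finite sets and their enumeration

∣p∪q∣≤∣p∣+∣q∣ : ∀ (p q : Subset n) → ∣ p ∪ q ∣ ≤ ∣ p ∣ + ∣ q ∣
∣p∪q∣≤∣p∣+∣q∣ []            []            = z≤n
∣p∪q∣≤∣p∣+∣q∣ (outside ∷ p) (outside ∷ q) = ∣p∪q∣≤∣p∣+∣q∣ p q
∣p∪q∣≤∣p∣+∣q∣ (inside  ∷ p) (outside ∷ q) = s≤s (∣p∪q∣≤∣p∣+∣q∣ p q)
∣p∪q∣≤∣p∣+∣q∣ (outside ∷ p) (inside  ∷ q) =
  ≤-trans (s≤s (∣p∪q∣≤∣p∣+∣q∣ p q)) (≤-reflexive (sym (+-suc ∣ p ∣ ∣ q ∣)))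
∣p∪q∣≤∣p∣+∣q∣ (inside  ∷ p) (inside  ∷ q) =
  s≤s (≤-trans (∣p∪q∣≤∣p∣+∣q∣ p q) (+-monoʳ-≤ ∣ p ∣ (n≤1+n ∣ q ∣)))

x∈p─q⇒x∉q : ∀ (p q : Subset n) {x} → x ∈ p ─ q → x ∉ q
x∈p─q⇒x∉q (inside ∷ p) (outside ∷ q) here         ()
x∈p─q⇒x∉q (_ ∷ p)      (outside ∷ q) (there x∈) (there x∈q) = x∈p─q⇒x∉q p q x∈ x∈q
x∈p─q⇒x∉q (_ ∷ p)      (inside ∷ q)  (there x∈) (there x∈q) = x∈p─q⇒x∉q p q x∈ x∈q

enumerate-∈ : ∀ (S : Subset n) i → enumerate S i ∈ S
enumerate-∈ (inside  ∷ S) zero    = here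
enumerate-∈ (inside  ∷ S) (suc i) = there (enumerate-∈ S i)
enumerate-∈ (outside ∷ S) i       = there (enumerate-∈ S i)

enumerate-injective : ∀ (S : Subset n) → Injective _≡_ _≡_ (enumerate S)
enumerate-injective (inside  ∷ S) {zero}  {zero}  _  = refl
enumerate-injective (inside  ∷ S) {suc i} {suc j} eq =
  cong suc (enumerate-injective S (suc-injective eq))
enumerate-injective (outside ∷ S) eq =
  enumerate-injective S (suc-injective eq)

index : ∀ {S : Subset n} {x} → x ∈ S → Fin ∣ S ∣
index {S = inside  ∷ S} here       = zero
index {S = inside  ∷ S} (there x∈) = suc (index x∈)
index {S = outside ∷ S} (there x∈) = index x∈

enumerate-index : ∀ {S : Subset n} {x} (x∈ : x ∈ S) → enumerate S (index x∈) ≡ x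
enumerate-index {S = inside  ∷ S} here       = refl
enumerate-index {S = inside  ∷ S} (there x∈) = cong suc (enumerate-index x∈)
enumerate-index {S = outside ∷ S} (there x∈) = cong suc (enumerate-index x∈)

-- Transports vertex sets of `G [ S ]` to `G`. Following the recursion of `enumerate` on `S` lets
-- sizes, intersections and singletons carry over by direct induction.
image : (S : Subset n) → Subset ∣ S ∣ → Subset n
image []            _       = []
image (inside  ∷ S) (b ∷ T) = b ∷ image S T
image (outside ∷ S) T       = outside ∷ image S T

∈-image⁺ : ∀ (S : Subset n) {T i} → i ∈ T → enumerate S i ∈ image S T
∈-image⁺ (inside  ∷ S) here       = here
∈-image⁺ (inside  ∷ S) (there i∈) = there (∈-image⁺ S i∈)
∈-image⁺ (outside ∷ S) i∈         = there (∈-image⁺ S i∈)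

∈-image⁻ : ∀ (S : Subset n) T {x} → x ∈ image S T →
           ∃ λ i → i ∈ T × enumerate S i ≡ x
∈-image⁻ (inside  ∷ S) (_ ∷ T) here       = zero , here , refl
∈-image⁻ (inside  ∷ S) (_ ∷ T) (there x∈)
  with i , i∈ , refl ← ∈-image⁻ S T x∈ = suc i , there i∈ , refl
∈-image⁻ (outside ∷ S) T       (there x∈)
  with i , i∈ , refl ← ∈-image⁻ S T x∈ = i , i∈ , refl

∣image∣ : ∀ (S : Subset n) T → ∣ image S T ∣ ≡ ∣ T ∣
∣image∣ []            []            = refl
∣image∣ (inside  ∷ S) (inside  ∷ T) = cong suc (∣image∣ S T)
∣image∣ (inside  ∷ S) (outside ∷ T) = ∣image∣ S T
∣image∣ (outside ∷ S) T             = ∣image∣ S T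

image-injective : ∀ (S : Subset n) → Injective _≡_ _≡_ (image S)
image-injective []            {[]}    {[]}    _  = refl
image-injective (inside  ∷ S) {_ ∷ _} {_ ∷ _} eq =
  cong₂ _∷_ (∷-injectiveˡ eq) (image-injective S (∷-injectiveʳ eq))
image-injective (outside ∷ S)                 eq = image-injective S (∷-injectiveʳ eq)

image-∩ : ∀ (S : Subset n) T U → image S (T ∩ U) ≡ image S T ∩ image S U
image-∩ []            _       _       = refl
image-∩ (inside  ∷ S) (_ ∷ T) (_ ∷ U) = cong (_ ∷_) (image-∩ S T U)
image-∩ (outside ∷ S) T       U       = cong (_ ∷_) (image-∩ S T U)

image-⊥ : ∀ (S : Subset n) → image S ⊥ ≡ ⊥
image-⊥ []            = refl
image-⊥ (inside  ∷ S) = cong (_ ∷_) (image-⊥ S)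
image-⊥ (outside ∷ S) = cong (_ ∷_) (image-⊥ S)

image-⁅⁆ : ∀ (S : Subset n) i → image S ⁅ i ⁆ ≡ ⁅ enumerate S i ⁆
image-⁅⁆ (inside  ∷ S) zero    = cong (_ ∷_) (image-⊥ S)
image-⁅⁆ (inside  ∷ S) (suc i) = cong (_ ∷_) (image-⁅⁆ S i)
image-⁅⁆ (outside ∷ S) i       = cong (_ ∷_) (image-⁅⁆ S i)

-- Induced subgraphs

≅-sym : ∀ G H → G ≅ H → H ≅ G
≅-sym G H (φ , adj≡) = ↔-sym φ , λ u v → sym
  (trans (adj≡ _ _) (cong₂ (adj H) (Inverse.strictlyInverseˡ φ u)
                                   (Inverse.strictlyInverseˡ φ v)))

≅-trans : ∀ G H K → G ≅ H → H ≅ K → G ≅ K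
≅-trans G H K (φ , adj≡) (ψ , adj≡′) =
  ↔-trans φ ψ , λ u v → trans (adj≡ u v) (adj≡′ _ _)

-- Source of the isomorphisms between induced subgraphs below. The inverse picks the preimages given
-- by `onto`; the round trips are identities because `enumerate S` and `e` can be cancelled.
embedding-≅ : ∀ G H {S : VertexSet G} (e : Vertex H → Vertex G) →
              Injective _≡_ _≡_ e →
              (∀ i j → adj H i j ≡ adj G (e i) (e j)) →
              (∀ i → e i ∈ S) → (∀ {x} → x ∈ S → ∃ λ i → e i ≡ x) →
              H ≅ G [ S ]
embedding-≅ G H {S} e inj adj≡ e∈S onto =
  mk↔ₛ′ to from to∘from from∘to , λ i j →
    trans (adj≡ i j) (sym (cong₂ (adj G) (enumerate-index (e∈S i))
                                         (enumerate-index (e∈S j))))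
  where
  to : Vertex H → Fin ∣ S ∣
  to i = index (e∈S i)

  from : Fin ∣ S ∣ → Vertex H
  from j = proj₁ (onto (enumerate-∈ S j))

  e∘from : ∀ j → e (from j) ≡ enumerate S j
  e∘from j = proj₂ (onto (enumerate-∈ S j))

  to∘from : ∀ j → to (from j) ≡ j
  to∘from j = enumerate-injective S
    (trans (enumerate-index (e∈S (from j))) (e∘from j))

  from∘to : ∀ i → from (to i) ≡ i
  from∘to i = inj (trans (e∘from (to i)) (enumerate-index (e∈S i)))

-- `U` is described by its members instead of being fixed as `image S T`, so that images,
-- complements and preimages can be treated alike.
restrict-restrict-≅ : ∀ G (S : VertexSet G) (T : VertexSet (G [ S ])) {U} →
  (∀ i → i ∈ T → enumerate S i ∈ U) →
  (∀ {x} → x ∈ U → ∃ λ i → i ∈ T × enumerate S i ≡ x) →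
  G [ S ] [ T ] ≅ G [ U ]
restrict-restrict-≅ G S T into onto = embedding-≅ G (G [ S ] [ T ]) (enumerate S ∘ enumerate T)
  (enumerate-injective T ∘ enumerate-injective S)
  (λ _ _ → refl)
  (λ i → into _ (enumerate-∈ T i))
  λ x∈U → let i , i∈T , eq = onto x∈U in
    index i∈T , trans (cong (enumerate S) (enumerate-index i∈T)) eq

image-≅ : ∀ G (S : VertexSet G) T → G [ S ] [ T ] ≅ G [ image S T ]
image-≅ G S T = restrict-restrict-≅ G S T (λ _ → ∈-image⁺ S) (∈-image⁻ S T)

-- Lets a modulator `Y` of the graph left by deleting `X` be completed by `X` to a modulator of `G`.
delete-delete-≅ : ∀ G (X : VertexSet G) (Y : VertexSet (G ∖ X)) →
                  G ∖ X ∖ Y ≅ G ∖ (X ∪ image (∁ X) Y)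
delete-delete-≅ G X Y = restrict-restrict-≅ G (∁ X) (∁ Y) into onto
  where
  into : ∀ i → i ∈ ∁ Y → enumerate (∁ X) i ∈ ∁ (X ∪ image (∁ X) Y)
  into i i∈∁Y = x∉p⇒x∈∁p λ x∈ → case (x∈p∪q⁻ X _ x∈)
    where
    case : ¬ (enumerate (∁ X) i ∈ X ⊎ enumerate (∁ X) i ∈ image (∁ X) Y)
    case (inj₁ x∈X) = x∈∁p⇒x∉p (enumerate-∈ (∁ X) i) x∈X
    case (inj₂ x∈Y) with j , j∈Y , eq ← ∈-image⁻ (∁ X) Y x∈Y
      with refl ← enumerate-injective (∁ X) eq = x∈∁p⇒x∉p i∈∁Y j∈Y

  onto : ∀ {x} → x ∈ ∁ (X ∪ image (∁ X) Y) →
         ∃ λ i → i ∈ ∁ Y × enumerate (∁ X) i ≡ x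
  onto {x} x∈ = index x∈∁X , x∉p⇒x∈∁p (λ i∈Y → x∉ (q⊆p∪q X _
                  (subst (_∈ image (∁ X) Y) eq (∈-image⁺ (∁ X) i∈Y)))) , eq
    where
    x∉ = x∈∁p⇒x∉p x∈
    x∈∁X : x ∈ ∁ X
    x∈∁X = x∉p⇒x∈∁p (x∉ ∘ p⊆p∪q _)
    eq = enumerate-index x∈∁X

-- Makes `v` alone a modulator of `G` minus `X - v` when `X` is a modulator of `G`, which is the
-- situation of the min-max hypothesis.
delete-rest-≅ : ∀ G (X : VertexSet G) {v} (v∈ : v ∈ ∁ (X - v)) → v ∈ X →
                G ∖ (X - v) ∖ ⁅ index v∈ ⁆ ≅ G ∖ X
delete-rest-≅ G X {v} v∈ v∈X = restrict-restrict-≅ G (∁ (X - v)) _ into onto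
  where
  into : ∀ i → i ∈ ∁ ⁅ index v∈ ⁆ → enumerate (∁ (X - v)) i ∈ ∁ X
  into i i∈ = x∉p⇒x∈∁p λ x∈X →
    x∈∁p⇒x∉p (enumerate-∈ (∁ (X - v)) i) (x∈p∧x≢y⇒x∈p-y x∈X λ eq →
      x∈∁p⇒x∉p i∈ (subst (_∈ ⁅ index v∈ ⁆)
        (enumerate-injective _ (trans (enumerate-index v∈) (sym eq)))
        (x∈⁅x⁆ _)))

  onto : ∀ {x} → x ∈ ∁ X → ∃ λ i → i ∈ ∁ ⁅ index v∈ ⁆ × enumerate (∁ (X - v)) i ≡ x
  -- A vertex outside `X` differs from `v`, as `v` lies in `X`.
  onto {x} x∈∁X = index x∈ , x∉p⇒x∈∁p (λ i∈ → x∈∁p⇒x∉p x∈∁X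
      (subst (_∈ X) (trans (sym (enumerate-index v∈))
                     (trans (cong (enumerate _) (sym (x∈⁅y⁆⇒x≡y _ i∈)))
                            (enumerate-index x∈))) v∈X))
    , enumerate-index x∈
    where
    x∈ : x ∈ ∁ (X - v)
    x∈ = x∉p⇒x∈∁p (x∈∁p⇒x∉p x∈∁X ∘ p─q⊆p X ⁅ v ⁆)

-- Flowers against modulators

-- Induced subgraphs of an induced subgraph are induced in `G`, so the flower number cannot grow on
-- passing to an induced subgraph.
Flower-image : ∀ {F : GraphClass f} {G p} (S : VertexSet G) {i} →
               Flower F (G [ S ]) i p → Flower F G (enumerate S i) p
Flower-image {G = G} S {i} fl = record
  { petal     = image S ∘ petal
  ; injective = injective ∘ image-injective S
  ; forbidden = λ j → let H , H∈F , iso = forbidden j in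
      H , H∈F , ≅-trans (G [ image S (petal j) ]) (G [ S ] [ petal j ]) H
        (≅-sym (G [ S ] [ petal j ]) (G [ image S (petal j) ]) (image-≅ G S (petal j))) iso
  ; meet      = λ j k j≢k → trans (sym (image-∩ S (petal j) (petal k)))
      (trans (cong (image S) (meet j k j≢k)) (image-⁅⁆ S i))
  }
  where open Flower fl

-- Otherwise `P` would survive the deletion of `X` and be a forbidden induced subgraph of a graph in
-- `C`.
forbidden-hit : ∀ {C : GraphClass c} {F : GraphClass f} → IsForb C F →
  ∀ G {X P : VertexSet G} → Modulator C G X → IsoToMember F (G [ P ]) →
  ∃ λ x → x ∈ P × x ∈ X
forbidden-hit {F = F} forb G {X} {P} mod (H , H∈F , iso) with nonempty? (P ∩ X)
... | yes (x , x∈) = x , x∈p∩q⁻ P X x∈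
... | no  empty    = contradiction
  (Q , H , H∈F , ≅-trans (G ∖ X [ Q ]) (G [ P ]) H
    (restrict-restrict-≅ G (∁ X) Q into onto) iso)
  (Equivalence.to (forb _) mod)
  where
  -- The preimage of `P` under `enumerate (∁ X)`; as `P` misses `X`, no vertex of `P` is lost.
  Q : VertexSet (G ∖ X)
  Q = tabulate (lookup P ∘ enumerate (∁ X))

  into : ∀ i → i ∈ Q → enumerate (∁ X) i ∈ P
  into i i∈ = lookup⇒[]= _ P (trans (sym (lookup∘tabulate _ i)) ([]=⇒lookup i∈))

  onto : ∀ {x} → x ∈ P → ∃ λ i → i ∈ Q × enumerate (∁ X) i ≡ x
  onto {x} x∈P = index x∈∁X
    , lookup⇒[]= _ Q (trans (lookup∘tabulate _ (index x∈∁X))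
        (trans (cong (lookup P) (enumerate-index x∈∁X)) ([]=⇒lookup x∈P)))
    , enumerate-index x∈∁X
    where
    x∈∁X : x ∈ ∁ X
    x∈∁X = x∉p⇒x∈∁p λ x∈X → empty (x , x∈p∩q⁺ (x∈P , x∈X))

-- Every petal contributes a vertex of `X`. Two petals share only `v`, which is outside `X`, so
-- these vertices are distinct.
petals≤modulator : ∀ {C : GraphClass c} {F : GraphClass f} → IsForb C F →
  ∀ G {v p X} → Flower F G v p → Modulator C G X → v ∉ X → p ≤ ∣ X ∣
petals≤modulator forb G {v} {p} {X} fl mod v∉X = injective⇒≤ hit-injective
  where
  open Flower fl

  hit : ∀ i → ∃ λ x → x ∈ petal i × x ∈ X
  hit i = forbidden-hit forb G mod (forbidden i)

  hit∈X : ∀ i → proj₁ (hit i) ∈ X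
  hit∈X i = proj₂ (proj₂ (hit i))

  hit-injective : Injective _≡_ _≡_ (λ i → index (hit∈X i))
  hit-injective {i} {j} eq with i ≟ j
  ... | yes i≡j = i≡j
  ... | no  i≢j = contradiction (subst (_∈ X) x≡v (hit∈X i)) v∉X
    where
    x≡y : proj₁ (hit i) ≡ proj₁ (hit j)
    x≡y = trans (sym (enumerate-index (hit∈X i)))
            (trans (cong (enumerate X) eq) (enumerate-index (hit∈X j)))
    x≡v : proj₁ (hit i) ≡ v
    x≡v = x∈⁅y⁆⇒x≡y v (subst (_ ∈_) (meet i j i≢j) (x∈p∩q⁺
      ( proj₁ (proj₂ (hit i))
      , subst (_∈ petal j) (sym x≡y) (proj₁ (proj₂ (hit j))))))

-- For negative `k` nothing is asked of `S`: no optimum is at most `k`, so both conditions hold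
-- vacuously.
largeFlowers-detect : ∀ (C : GraphClass c) (F : GraphClass f) →
  Hereditary C → IsForb C F →
  (∀ G v → C (G ∖ ⁅ v ⁆) →
     ∃ λ m → IsMinSize (λ S → Modulator C G S × v ∉ S) m ×
             IsFlowerNumber F G v m) →
  ∀ G k (flowers : Vertex G → ℕ) → (∀ v → IsFlowerNumber F G v (flowers v)) →
  ∀ S → (∀ {n} → k ≡ + n → ∀ v → v ∈ S ⇔ n < flowers v) →
  EssentialDetection 2 (Deletion C) G k S
largeFlowers-detect C F her forb minmax G k flowers isFlower S S-spec =
  record { G1 = G1 ; G2 = G2 }
  where
  open Hereditary her

  G1 : ∀ m → IsOpt (Deletion C) G m → + m ℤ.≤ k →
       ∃ λ X → OptimalSolution (Deletion C) G X × S ⊆ X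
  G1 m ((X , mod , refl) , min) (+≤+ m≤n) = X , (mod , (X , mod , refl) , min) , S⊆X
    where
    S⊆X : S ⊆ X
    S⊆X {v} v∈S with v ∈? X
    ... | yes v∈X = v∈X
    ... | no  v∉X = contradiction
      (≤-trans (petals≤modulator forb G (proj₁ (isFlower v)) mod v∉X) m≤n)
      (<⇒≱ (Equivalence.to (S-spec refl v) v∈S))

  G2 : ∀ m → IsOpt (Deletion C) G m → + m ≡ k →
       ∀ v → Essential 2 (Deletion C) G v → v ∈ S
  G2 m opt@((X , mod , ∣X∣≡m) , _) refl v ess =
    Equivalence.from (S-spec refl v) (≰⇒> few-petals)
    where
    v∈X : v ∈ X
    v∈X = ess m opt X mod (≤-trans (≤-reflexive ∣X∣≡m) (m≤n*m m 2))

    X′ : VertexSet G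
    X′ = X - v

    v∈ : v ∈ ∁ X′
    v∈ = x∉p⇒x∈∁p λ v∈X′ → x∈p─q⇒x∉q X ⁅ v ⁆ v∈X′ (x∈⁅x⁆ v)

    G′ : Graph
    G′ = G ∖ X′

    v′ : Vertex G′
    v′ = index v∈

    few-petals : ¬ (flowers v ≤ m)
    few-petals fl≤m
      with q , ((Y , (Y-mod , v∉Y) , ∣Y∣≡q) , _) , fl , _ ←
             minmax G′ v′
                    (resp-≅ {G ∖ X} {G′ ∖ ⁅ v′ ⁆}
                            (≅-sym (G′ ∖ ⁅ v′ ⁆) (G ∖ X) (delete-rest-≅ G X v∈ v∈X)) mod)
      = v∉Z (ess m opt Z (resp-≅ {G′ ∖ Y} {G ∖ Z} (delete-delete-≅ G X′ Y) Y-mod) ∣Z∣≤2m)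
      where
      Z : VertexSet G
      Z = X′ ∪ image (∁ X′) Y

      v∉Z : v ∉ Z
      v∉Z v∈Z with x∈p∪q⁻ X′ _ v∈Z
      ... | inj₁ v∈X′ = x∈∁p⇒x∉p v∈ v∈X′
      ... | inj₂ v∈Y with i , i∈Y , eq ← ∈-image⁻ (∁ X′) Y v∈Y =
        v∉Y (subst (_∈ Y) (enumerate-injective _ (trans eq (sym (enumerate-index v∈)))) i∈Y)

      q≤m : q ≤ m
      -- `Flower-image` centres the flower at the vertex enumerated by `v′`, which `enumerate-index`
      -- identifies with `v`.
      q≤m = ≤-trans (proj₂ (isFlower v) q
              (subst (λ u → Flower F G u q) (enumerate-index v∈) (Flower-image _ fl))) fl≤m

      open ≤-Reasoning
      ∣Z∣≤2m : ∣ Z ∣ ≤ 2 * m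
      ∣Z∣≤2m = begin
        ∣ Z ∣                                ≤⟨ ∣p∪q∣≤∣p∣+∣q∣ X′ _ ⟩
        ∣ X′ ∣ + ∣ image (∁ X′) Y ∣          ≡⟨ cong (_+_ ∣ X′ ∣) (∣image∣ (∁ X′) Y) ⟩
        -- The crude bound by the size of `X` suffices, since a total of `m + m` is allowed.
        ∣ X′ ∣ + ∣ Y ∣                       ≤⟨ +-mono-≤ (∣p─q∣≤∣p∣ X ⁅ v ⁆) (≤-reflexive ∣Y∣≡q) ⟩
        ∣ X ∣ + q                            ≤⟨ +-mono-≤ (≤-reflexive ∣X∣≡m) q≤m ⟩
        m + m                                ≡⟨ cong (_+_ m) (+-identityʳ m) ⟨
        2 * m                                ∎

-- Comparison of binary numerals

-- Reading the digits from the least significant one, the bit b tells whether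
-- the part of p already read exceeds that of k.  In bijective base 2 the
-- longer numeral is the greater one.

updateBit : Bool → Bool → Bool → Bool
updateBit true  true  b = b
updateBit true  false _ = true
updateBit false true  _ = false
updateBit false false b = b

exceeds : Bool → ℕᵇ → ℕᵇ → Bool
exceeds b Bin.zero Bin.zero = b
exceeds b Bin.zero 2[1+ _ ] = false
exceeds b Bin.zero 1+[2 _ ] = false
exceeds b 2[1+ _ ] Bin.zero = true
exceeds b 1+[2 _ ] Bin.zero = true
exceeds b 2[1+ p ] 2[1+ k ] = exceeds b p k
exceeds b 2[1+ p ] 1+[2 k ] = exceeds true p k
exceeds b 1+[2 p ] 2[1+ k ] = exceeds false p k
exceeds b 1+[2 p ] 1+[2 k ] = exceeds b p k

-- The bit decides ties among the digits still to be read: a tie counts as exceeding only if the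
-- digits already read do.
Exceeds : Bool → ℕᵇ → ℕᵇ → Set
Exceeds false p k = k Bin.< p
Exceeds true  p k = k Bin.≤ p

-- The recursion matches the constructors of `Bin._<_`: `odd<even` takes a weak inequality between
-- the remaining digits and `even<odd` a strict one, just as the bit becomes `true` or `false`.
exceeds-sound : ∀ b p k → exceeds b p k ≡ true → Exceeds b p k
exceeds-sound true  Bin.zero Bin.zero _  = inj₂ refl
exceeds-sound false 2[1+ p ] Bin.zero _  = Bin.0<even
exceeds-sound true  2[1+ p ] Bin.zero _  = inj₁ Bin.0<even
exceeds-sound false 1+[2 p ] Bin.zero _  = Bin.0<odd
exceeds-sound true  1+[2 p ] Bin.zero _  = inj₁ Bin.0<odd
exceeds-sound false 2[1+ p ] 2[1+ k ] eq = Bin.even<even (exceeds-sound false p k eq)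
exceeds-sound true  2[1+ p ] 2[1+ k ] eq with exceeds-sound true p k eq
... | inj₁ k<p  = inj₁ (Bin.even<even k<p)
... | inj₂ refl = inj₂ refl
exceeds-sound false 2[1+ p ] 1+[2 k ] eq = Bin.odd<even (exceeds-sound true p k eq)
exceeds-sound true  2[1+ p ] 1+[2 k ] eq = inj₁ (Bin.odd<even (exceeds-sound true p k eq))
exceeds-sound false 1+[2 p ] 2[1+ k ] eq = Bin.even<odd (exceeds-sound false p k eq)
exceeds-sound true  1+[2 p ] 2[1+ k ] eq = inj₁ (Bin.even<odd (exceeds-sound false p k eq))
exceeds-sound false 1+[2 p ] 1+[2 k ] eq = Bin.odd<odd (exceeds-sound false p k eq)
exceeds-sound true  1+[2 p ] 1+[2 k ] eq with exceeds-sound true p k eq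
... | inj₁ k<p  = inj₁ (Bin.odd<odd k<p)
... | inj₂ refl = inj₂ refl

exceeds-complete : ∀ b p k → Exceeds b p k → exceeds b p k ≡ true
exceeds-complete true  Bin.zero Bin.zero _ = refl
exceeds-complete true  Bin.zero 2[1+ k ] (inj₁ ())
exceeds-complete true  Bin.zero 1+[2 k ] (inj₁ ())
exceeds-complete b     2[1+ p ] Bin.zero _ = refl
exceeds-complete b     1+[2 p ] Bin.zero _ = refl
exceeds-complete false 2[1+ p ] 2[1+ k ] (Bin.even<even lt) = exceeds-complete false p k lt
exceeds-complete true  2[1+ p ] 2[1+ k ] (inj₁ (Bin.even<even lt)) =
  exceeds-complete true p k (inj₁ lt)
exceeds-complete true  2[1+ p ] 2[1+ k ] (inj₂ refl) = exceeds-complete true p k (inj₂ refl)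
exceeds-complete false 2[1+ p ] 1+[2 k ] (Bin.odd<even le) = exceeds-complete true p k le
exceeds-complete true  2[1+ p ] 1+[2 k ] (inj₁ (Bin.odd<even le)) = exceeds-complete true p k le
exceeds-complete false 1+[2 p ] 2[1+ k ] (Bin.even<odd lt) = exceeds-complete false p k lt
exceeds-complete true  1+[2 p ] 2[1+ k ] (inj₁ (Bin.even<odd lt)) = exceeds-complete false p k lt
exceeds-complete false 1+[2 p ] 1+[2 k ] (Bin.odd<odd lt) = exceeds-complete false p k lt
exceeds-complete true  1+[2 p ] 1+[2 k ] (inj₁ (Bin.odd<odd lt)) =
  exceeds-complete true p k (inj₁ lt)
exceeds-complete true  1+[2 p ] 1+[2 k ] (inj₂ refl) = exceeds-complete true p k (inj₂ refl)

exceeds-fromℕ : ∀ m n → exceeds false (Bin.fromℕ m) (Bin.fromℕ n) ≡ true ⇔ n < m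
exceeds-fromℕ m n = mk⇔
  (λ eq → Bin.fromℕ-cancel-< (exceeds-sound false (Bin.fromℕ m) (Bin.fromℕ n) eq))
  (λ n<m → exceeds-complete false (Bin.fromℕ m) (Bin.fromℕ n) (Bin.fromℕ-mono-< n<m))

-- Time bounds and the comparison program

infix 4 _⊢_⇓_within_

_⊢_⇓_within_ : Program → Tree → Tree → ℕ → Set
p ⊢ x ⇓ y within T = ∃ λ t → p ⊢ x ⇓ y ⟨ t ⟩ × t ≤ T

weaken : ∀ {p x y s t} → s ≤ t → p ⊢ x ⇓ y within s → p ⊢ x ⇓ y within t
weaken s≤t (_ , run , r≤s) = _ , run , ≤-trans r≤s s≤t

seq-within : ∀ {p q x y z s t} → p ⊢ x ⇓ y within s → q ⊢ y ⇓ z within t →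
             p ⨾ q ⊢ x ⇓ z within (suc (s + t))
seq-within (_ , run , ≤s) (_ , run′ , ≤t) = _ , seq run run′ , s≤s (+-mono-≤ ≤s ≤t)

0<size : ∀ x → 0 < size x
0<size nil        = s≤s z≤n
0<size (cons _ _) = s≤s z≤n

-- The store is a triple (b , p , k).

compareStep : Program
compareStep =
  pair (if (tl ⨾ hd ⨾ hd)
           (if (tl ⨾ tl ⨾ hd) hd (const (encodeBool true)))
           (if (tl ⨾ tl ⨾ hd) (const (encodeBool false)) hd))
       (pair (tl ⨾ hd ⨾ tl) (tl ⨾ tl ⨾ tl))

-- The guard is a conjunction: it returns what is left of `k` if `p` has digits left and `nil`
-- otherwise, hence is true as long as both have digits.
compareLoop : Program
compareLoop = while (if (tl ⨾ hd) (tl ⨾ tl) (const nil)) compareStep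

-- After the loop at most one numeral has digits left, and that one is the greater; if neither has,
-- the bit decides.
compareRest : Program
compareRest = if (tl ⨾ hd) (const (encodeBool true))
                 (if (tl ⨾ tl) (const (encodeBool false)) hd)

compare : Program
compare = compareLoop ⨾ compareRest

-- All four branches of the nested conditional take 13 steps, which gives one exact time for every
-- pair of digits.
compareStep-⇓ : ∀ d e b {x y} →
  compareStep ⊢ cons (encodeBool b) (cons (cons (encodeBool d) x) (cons (encodeBool e) y))
              ⇓ cons (encodeBool (updateBit d e b)) (cons x y) ⟨ 25 ⟩
compareStep-⇓ d e b = pair (update d e) (pair (seq tl (seq hd tl)) (seq tl (seq tl tl)))
  where
  update : ∀ d e {x y} →
    _ ⊢ cons (encodeBool b) (cons (cons (encodeBool d) x) (cons (encodeBool e) y))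
      ⇓ encodeBool (updateBit d e b) ⟨ 13 ⟩
  update true  true  = if-true  (seq tl (seq hd hd)) (if-true  (seq tl (seq tl hd)) hd)
  update true  false = if-true  (seq tl (seq hd hd)) (if-false (seq tl (seq tl hd)) const)
  update false true  = if-false (seq tl (seq hd hd)) (if-true  (seq tl (seq tl hd)) const)
  update false false = if-false (seq tl (seq hd hd)) (if-false (seq tl (seq tl hd)) hd)

compare-shorter : ∀ b d k →
  compare ⊢ cons (encodeBool b) (cons nil (cons (encodeBool d) (encodeℕᵇ k)))
          ⇓ encodeBool false within (33 * suc (size (encodeBool d) + size (encodeℕᵇ k)))
compare-shorter b d k =
  _ , seq (while-stop (if-false (seq tl hd) const))
          (if-false (seq tl hd) (if-true (seq tl tl) const))
    , ≤-trans (m≤m+n 16 17) (*-monoʳ-≤ 33 (s≤s z≤n))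

compare-longer : ∀ b {x y} →
  compare ⊢ cons (encodeBool b) (cons (cons x y) nil) ⇓ encodeBool true within 33
compare-longer b =
  _ , seq (while-stop (if-true (seq tl hd) (seq tl tl))) (if-true (seq tl hd) const)
    , m≤m+n 14 19

compare-digits : ∀ d e b {x z} k →
  compare ⊢ cons (encodeBool (updateBit d e b)) (cons x (encodeℕᵇ k)) ⇓ z
          within (33 * size (encodeℕᵇ k)) →
  compare ⊢ cons (encodeBool b) (cons (cons (encodeBool d) x)
                                      (cons (encodeBool e) (encodeℕᵇ k))) ⇓ z
          within (33 * suc (size (encodeBool e) + size (encodeℕᵇ k)))
compare-digits d e b k (_ , seq loop rest , t≤) =
  -- A round costs 33 = 1 + 7 + 25 steps: `while` itself, the guard and `compareStep`.
  _ , seq (while-step guard (compareStep-⇓ d e b) loop) rest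
    , (begin
        _                                                   ≤⟨ +-monoʳ-≤ 33 t≤ ⟩
        33 + 33 * size (encodeℕᵇ k)                         ≡⟨ *-suc 33 _ ⟨
        33 * suc (size (encodeℕᵇ k))                        ≤⟨ *-monoʳ-≤ 33 (s≤s (m≤n+m _ _)) ⟩
        33 * suc (size (encodeBool e) + size (encodeℕᵇ k))  ∎)
  where
  open ≤-Reasoning
  guard = if-true (seq tl hd) (seq tl tl)

-- The loop ends with the shorter numeral, so the length of `k` alone bounds the time, however long
-- `p` is. The work after the last round fits into 33 steps as well.
compare-⇓ : ∀ b p k →
  compare ⊢ cons (encodeBool b) (cons (encodeℕᵇ p) (encodeℕᵇ k))
          ⇓ encodeBool (exceeds b p k) within (33 * size (encodeℕᵇ k))
compare-⇓ b Bin.zero Bin.zero =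
  _ , seq (while-stop (if-false (seq tl hd) const))
          (if-false (seq tl hd) (if-false (seq tl tl) hd)) , m≤m+n 16 17
compare-⇓ b Bin.zero 2[1+ k ] = compare-shorter b true k
compare-⇓ b Bin.zero 1+[2 k ] = compare-shorter b false k
compare-⇓ b 2[1+ p ] Bin.zero = compare-longer b
compare-⇓ b 1+[2 p ] Bin.zero = compare-longer b
compare-⇓ b 2[1+ p ] 2[1+ k ] = compare-digits true true b k (compare-⇓ b p k)
compare-⇓ b 2[1+ p ] 1+[2 k ] = compare-digits true false b k (compare-⇓ true p k)
compare-⇓ b 1+[2 p ] 2[1+ k ] = compare-digits false true b k (compare-⇓ false p k)
compare-⇓ b 1+[2 p ] 1+[2 k ] = compare-digits false false b k (compare-⇓ b p k)

-- The detection program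

-- The order of the graph is recovered by counting the rows of its adjacency matrix, in unary
-- because vertices are written in unary.
lengthStep : Program
lengthStep = pair (hd ⨾ tl) (pair (pair (const nil) (tl ⨾ hd)) (tl ⨾ tl))

lengthLoop-⇓ : ∀ {A : Set a} (e : A → Tree) (xs : Vec A n) m {x} →
  while hd lengthStep ⊢ cons (encodeVec e xs) (cons (encodeFin (fromℕ m)) x)
                      ⇓ cons nil (cons (encodeFin (fromℕ (n + m))) x)
                      within (n * 15 + 2)
lengthLoop-⇓ e []       m = _ , while-stop hd , ≤-refl
lengthLoop-⇓ {n = suc n} e (_ ∷ xs) m
  with _ , loop , t≤ ← lengthLoop-⇓ e xs (suc m)
  rewrite +-suc n m =
  _ , while-step hd (pair (seq hd tl) (pair (pair const (seq tl hd)) (seq tl tl))) loop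
    , +-monoʳ-≤ 15 t≤

-- An encoded subset with an arbitrary tail: the list of results part way through the sweep.
prependBits : (Fin n → Bool) → Tree → Tree
prependBits {zero}  h x = x
prependBits {suc n} h x = cons (encodeBool (h zero)) (prependBits (h ∘ suc) x)

-- One round of the sweep: the bit of the last vertex goes onto the list first, those of the smaller
-- vertices follow.
prependBits-last : ∀ (h : Fin (suc n) → Bool) x →
  prependBits (h ∘ inject₁) (cons (encodeBool (h (fromℕ n))) x) ≡ prependBits h x
prependBits-last {zero}  h x = refl
prependBits-last {suc n} h x = cong (cons _) (prependBits-last (h ∘ suc) x)

prependBits-nil : ∀ (h : Fin n → Bool) → prependBits h nil ≡ encodeSubset (tabulate h)
prependBits-nil {zero}  h = refl
prependBits-nil {suc n} h = cong (cons _) (prependBits-nil (h ∘ suc))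

encodeFin-inject₁ : ∀ (i : Fin n) → encodeFin (inject₁ i) ≡ encodeFin i
encodeFin-inject₁ zero    = refl
encodeFin-inject₁ (suc i) = cong (cons nil) (encodeFin-inject₁ i)

-- The vertices are visited in decreasing order, so that the list of results
-- comes out in increasing order.
sweep-⇓ : ∀ {step x T} (h : Fin n → Bool) →
  (∀ i y → step ⊢ cons (cons nil (encodeFin i)) (cons y x)
                ⇓ cons (encodeFin i) (cons (cons (encodeBool (h i)) y) x) within T) →
  ∀ y → while hd step ⊢ cons (encodeFin (fromℕ n)) (cons y x)
                      ⇓ cons nil (cons (prependBits h y) x) within (n * (2 + T) + 2)
sweep-⇓ {zero}  h step-⇓ y = _ , while-stop hd , ≤-refl
sweep-⇓ {suc n} {step} {x} {T} h step-⇓ y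
  rewrite sym (prependBits-last h y)
  with _ , first , s≤T ← step-⇓ (fromℕ n) y
  -- The vertices still to be visited are embedded by `inject₁`, which leaves their unary codes
  -- unchanged.
  with _ , loop , t≤ ← sweep-⇓ {step = step} {T = T} (h ∘ inject₁)
         (λ i z → subst (λ u → step ⊢ cons (cons nil u) (cons z x)
                                    ⇓ cons u (cons (cons (encodeBool (h (inject₁ i))) z) x)
                                    within T)
                        (encodeFin-inject₁ i) (step-⇓ (inject₁ i) z))
         (cons (encodeBool (h (fromℕ n))) y)
  = _ , while-step hd first loop
  , s≤s (s≤s (≤-trans (+-mono-≤ s≤T t≤) (≤-reflexive (sym (+-assoc T _ 2)))))

-- The store is (u , bits , G , sign , k), where the next vertex is u − 1.

testVertex : Program → Program
testVertex P =
  pair (const nil) (pair (pair (tl ⨾ tl ⨾ hd) (hd ⨾ tl) ⨾ P) (tl ⨾ tl ⨾ tl ⨾ tl))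
  ⨾ compare

vertexStep : Program → Program
vertexStep P = pair (hd ⨾ tl) (pair (pair (testVertex P) (tl ⨾ hd)) (tl ⨾ tl))

-- Counting consumes the rows, so the graph is copied first. The count then serves as the vertex
-- counter of the sweep, whose list of results starts empty.
detect : Program → Program
detect P =
  pair hd (pair (const nil) skip)
  ⨾ while hd lengthStep
  ⨾ pair (tl ⨾ hd) (pair (const nil) (tl ⨾ tl))
  ⨾ while hd (vertexStep P)
  ⨾ tl ⨾ hd

vertexStep-⇓ : ∀ {P u y g s p k T} → P ⊢ cons g u ⇓ encodeℕᵇ p within T →
  vertexStep P ⊢ cons (cons nil u) (cons y (cons g (cons s (encodeℕᵇ k))))
               ⇓ cons u (cons (cons (encodeBool (exceeds false p k)) y)
                              (cons g (cons s (encodeℕᵇ k))))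
               within (33 + (T + 33 * size (encodeℕᵇ k)))
vertexStep-⇓ {p = p} {k} {T} (t , call , t≤T)
  -- The initial bit `false`, supplied by `const nil`, makes the comparison strict.
  with c , comp , c≤ ← compare-⇓ false p k =
  _ , pair (seq hd tl) (pair (pair
        (seq (pair const (pair (seq (pair (seq tl (seq tl hd)) (seq hd tl)) call)
                               (seq tl (seq tl (seq tl tl)))))
             comp)
        (seq tl hd)) (seq tl tl))
    , ≤-trans (≤-reflexive (time t c)) (+-monoʳ-≤ 33 (+-mono-≤ t≤T c≤))
  where
  time : ∀ t c → 4 + (suc (suc (suc (suc (suc (suc (suc (9 + t)) + 7)) + c) + 3) + 3))
                 ≡ 33 + (t + c)
  time = solve-∀

detect-⇓ : ∀ {A : Set a} {P} (e : A → Tree) (xs : Vec A n) s k (p : Fin n → ℕᵇ) T →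
  (∀ i → P ⊢ cons (encodeVec e xs) (encodeFin i) ⇓ encodeℕᵇ (p i) within T) →
  detect P ⊢ cons (encodeVec e xs) (cons s (encodeℕᵇ k))
           ⇓ encodeSubset (tabulate λ i → exceeds false (p i) k)
           within (25 + n * (50 + (T + 33 * size (encodeℕᵇ k))))
detect-⇓ {n = n} {P = P} e xs s k p T P-⇓ =
  subst (λ y → detect P ⊢ _ ⇓ y within _) (prependBits-nil bits)
    (weaken (≤-reflexive (total n R))
      (seq-within (_ , pair hd (pair const skip) , ≤-refl)
      (seq-within measure
      (seq-within (_ , pair (seq tl hd) (pair const (seq tl tl)) , ≤-refl)
      (seq-within loop
                  (_ , seq tl hd , ≤-refl))))))
  where
  g = encodeVec e xs
  x = cons g (cons s (encodeℕᵇ k))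
  R = T + 33 * size (encodeℕᵇ k)

  bits : Fin n → Bool
  bits i = exceeds false (p i) k

  measure : while hd lengthStep ⊢ cons g (cons nil x)
            ⇓ cons nil (cons (encodeFin (fromℕ n)) x) within (n * 15 + 2)
  measure = subst (λ m → while hd lengthStep ⊢ cons g (cons nil x)
                         ⇓ cons nil (cons (encodeFin (fromℕ m)) x) within (n * 15 + 2))
                  (+-identityʳ n) (lengthLoop-⇓ e xs 0)

  loop : while hd (vertexStep P) ⊢ cons (encodeFin (fromℕ n)) (cons nil x)
         ⇓ cons nil (cons (prependBits bits nil) x) within (n * (35 + R) + 2)
  loop = sweep-⇓ bits (λ i y → vertexStep-⇓ {P} {p = p i} {k} (P-⇓ i)) nil

  -- Here 50 = 15 + 2 + 33 per vertex: a round of counting, the overhead of the sweep, and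
  -- `vertexStep` apart from the flower computation and the comparison.
  total : ∀ n R → suc (5 + suc (n * 15 + 2 + suc (9 + suc (n * (35 + R) + 2 + 3))))
                  ≡ 25 + n * (50 + R)
  total = solve-∀

-- Polynomial bound on the running time

*-^-distrib : ∀ m n d → (m * n) ^ d ≡ m ^ d * n ^ d
*-^-distrib m n zero    = refl
*-^-distrib m n (suc d) =
  trans (cong (m * n *_) (*-^-distrib m n d)) ([m*n]*[o*p]≡[m*o]*[n*p] m n (m ^ d) (n ^ d))

size-encodeFin : ∀ {A : Set a} (e : A → Tree) (xs : Vec A n) (i : Fin n) →
                 size (encodeFin i) ≤ size (encodeVec e xs)
size-encodeFin e (x ∷ xs) zero    = s≤s z≤n
size-encodeFin e (x ∷ xs) (suc i) =
  s≤s (+-mono-≤ (0<size (e x)) (size-encodeFin e xs i))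

length≤size : ∀ {A : Set a} (e : A → Tree) (xs : Vec A n) → n ≤ size (encodeVec e xs)
length≤size e []       = z≤n
length≤size e (x ∷ xs) = s≤s (≤-trans (length≤size e xs) (m≤n+m _ (size (e x))))

-- One factor `N` pays for the number of vertices and `N ^ (1 + d)` for the work at each; 108 = 25 +
-- 50 + 33 collects the constants.
time-polynomial : ∀ {n N k T c d} → 1 ≤ N → n ≤ N → k ≤ N → T ≤ c * (2 * N) ^ d →
                  25 + n * (50 + (T + 33 * k)) ≤ (108 + c * 2 ^ d) * N ^ (2 + d)
time-polynomial {n} {N} {k} {T} {c} {d} 1≤N n≤N k≤N T≤ = begin
  25 + n * (50 + (T + 33 * k))
    ≤⟨ +-mono-≤ (*-monoʳ-≤ 25 1≤ND)
         (*-mono-≤ n≤N (+-mono-≤ (*-monoʳ-≤ 50 1≤D) (+-mono-≤ T≤D (*-monoʳ-≤ 33 k≤D)))) ⟩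
  25 * (N * D) + N * (50 * D + (c * 2 ^ d * D + 33 * D))
    ≡⟨ collect N D (c * 2 ^ d) ⟩
  (108 + c * 2 ^ d) * (N * D) ∎
  where
  open ≤-Reasoning
  instance _ = >-nonZero 1≤N
  -- A common bound for 1, `k` and `N ^ d`, available because `N` is positive.
  D = N ^ (1 + d)

  1≤D : 1 ≤ D
  1≤D = m^n>0 N (1 + d)

  1≤ND : 1 ≤ N * D
  1≤ND = m^n>0 N (2 + d)

  k≤D : k ≤ D
  k≤D = ≤-trans k≤N (m≤m*n N (N ^ d) {{>-nonZero (m^n>0 N d)}})

  T≤D : T ≤ c * 2 ^ d * D
  T≤D = begin
    T                      ≤⟨ T≤ ⟩
    c * (2 * N) ^ d        ≡⟨ cong (c *_) (*-^-distrib 2 N d) ⟩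
    c * (2 ^ d * N ^ d)    ≡⟨ *-assoc c (2 ^ d) (N ^ d) ⟨
    c * 2 ^ d * N ^ d      ≤⟨ *-monoʳ-≤ (c * 2 ^ d) (m≤n*m (N ^ d) N) ⟩
    c * 2 ^ d * D          ∎

  collect : ∀ N D E → 25 * (N * D) + N * (50 * D + (E * D + 33 * D)) ≡ (108 + E) * (N * D)
  collect = solve-∀

theorem3 : ∀ {c f : Level} (C : GraphClass c) (F : GraphClass f) →
    Hereditary C →
    IsForb C F →
    (∀ (G : Graph) (v : Vertex G) → C (G ∖ ⁅ v ⁆) →
    ∃ λ m → IsMinSize (λ S → Modulator C G S × v ∉ S) m ×
    IsFlowerNumber F G v m) →
    PolyTimeFlowerNumber F →
    PolyTimeEssentialDetection 2 (Deletion C)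
theorem3 C F her forb minmax alg = record
  { program = detect program
  ; coeff   = 108 + coeff * 2 ^ degree
  ; degree  = 2 + degree
  ; solves  = solution
  }
  where
  open PolyTimeAlgorithm alg

  flowers : ∀ G → Vertex G → ℕ
  flowers G v = proj₁ (solves (G , v))

  isFlower : ∀ G v → IsFlowerNumber F G v (flowers G v)
  isFlower G v = proj₂ (proj₂ (proj₂ (proj₂ (solves (G , v)))))

  -- For negative `k` any output is correct, so the number encoded behind the sign can be taken.
  threshold : ℤ → ℕ
  threshold (+ n)    = n
  threshold -[1+ n ] = n

  sign : ℤ → Bool
  sign (+ _)    = false
  sign -[1+ _ ] = true

  -- Gives both signs one shape, so that the run is analysed without cases on `k`.
  encodeℤ-split : ∀ k → encodeℤ k ≡ cons (encodeBool (sign k)) (encodeℕ (threshold k))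
  encodeℤ-split (+ _)    = refl
  encodeℤ-split -[1+ _ ] = refl

  bit : ∀ G → ℤ → Vertex G → Bool
  bit G k v = exceeds false (Bin.fromℕ (flowers G v)) (Bin.fromℕ (threshold k))

  solution : ∀ ((G , k) : Graph × ℤ) → ∃ λ S → ∃ λ t →
    detect program ⊢ encodeGraphInteger (G , k) ⇓ encodeSubset S ⟨ t ⟩ ×
    t ≤ (108 + coeff * 2 ^ degree) * size (encodeGraphInteger (G , k)) ^ (2 + degree) ×
    EssentialDetection 2 (Deletion C) G k S
  solution (G , k) =
      tabulate (bit G k) , t , run
    , ≤-trans t≤ (time-polynomial {c = coeff} {degree} (s≤s z≤n) n≤N k≤N ≤-refl)
    , largeFlowers-detect C F her forb minmax G k (flowers G) (isFlower G) _
        -- For `k` equal to `+ n` the threshold reduces to `n`.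
        λ { refl v → mk⇔
              (λ v∈ → Equivalence.to (exceeds-fromℕ (flowers G v) _)
                        (trans (sym (lookup∘tabulate (bit G k) v)) ([]=⇒lookup v∈)))
              (λ n<m → lookup⇒[]= v _ (trans (lookup∘tabulate (bit G k) v)
                        (Equivalence.from (exceeds-fromℕ (flowers G v) _) n<m))) }
    where
    rows = tabulate λ u → tabulate (adj G u)
    kˢ = size (encodeℕ (threshold k))
    N  = size (encodeGraphInteger (G , k))
    T  = coeff * (2 * N) ^ degree

    g<N : size (encodeGraph G) < N
    g<N = s≤s (m≤m+n _ _)

    n≤N : order G ≤ N
    n≤N = ≤-trans (length≤size (encodeVec encodeBool) rows) (<⇒≤ g<N)

    k≤N : kˢ ≤ N
    k≤N rewrite encodeℤ-split k =
      m≤n⇒m≤1+n (m≤n⇒m≤o+n _ (m≤n⇒m≤1+n (m≤n+m kˢ (size (encodeBool (sign k))))))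

    -- The strictness of `g<N` pays for the `cons` joining graph and vertex, and the unary vertex is
    -- at most as large as the matrix. This makes `T` a bound for all vertices at once.
    input≤2N : ∀ v → size (encodeGraphVertex (G , v)) ≤ 2 * N
    input≤2N v = +-mono-≤ g<N (≤-trans (size-encodeFin (encodeVec encodeBool) rows v)
                   (≤-trans (<⇒≤ g<N) (m≤m+n N 0)))

    call : ∀ v → program ⊢ encodeGraphVertex (G , v) ⇓ encodeℕ (flowers G v) within T
    call v with _ , t , run , t≤ , _ ← solves (G , v) =
      t , run , ≤-trans t≤ (*-monoʳ-≤ coeff (^-monoˡ-≤ degree (input≤2N v)))

    detected : detect program ⊢ encodeGraphInteger (G , k) ⇓ encodeSubset (tabulate (bit G k))
               within (25 + order G * (50 + (T + 33 * kˢ)))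
    detected = subst
      (λ x → detect program ⊢ cons (encodeGraph G) x ⇓ encodeSubset (tabulate (bit G k))
             within (25 + order G * (50 + (T + 33 * kˢ))))
      (sym (encodeℤ-split k))
      (detect-⇓ {P = program} (encodeVec encodeBool) rows (encodeBool (sign k))
        (Bin.fromℕ (threshold k)) (Bin.fromℕ ∘ flowers G) T call)

    t   = proj₁ detected
    run = proj₁ (proj₂ detected)
    t≤  = proj₂ (proj₂ detected)
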